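{- The generating function for the number of restricted growth sequences of length $n$ ($n\ge 0$) that avoid $\{12313,12323\}$ is $$\sum_{n\ge0}|\mathcal P_n(\{12313,12323\})|\,x^n=\frac{1}{1-x}+\frac{x}{2(1-x)}\left(\frac{1}{\sqrt{1-4x}}-1\right).$$
   Context: A restricted growth sequence of length $n$ is a sequence of positive integers $\pi=\pi_1\cdots\pi_n$ with $\pi_1=1$ and $\pi_{j+1}\le 1+\max\{\pi_1,\dots,\pi_j\}$ for all $1\le j<n$ (the empty sequence is the only one of length $0$). Such a sequence contains a pattern $\tau$ if it has a (not necessarily consecutive) subsequence order isomorphic to $\tau$ (same relative order, including equalities); otherwise it avoids $\tau$. $\mathcal P_n(B)$ is the set of restricted growth sequences of length $n$ that avoid all patterns in $B$. -}

module Defs where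

open import Data.Fin as Fin using (Fin; zero; suc; toℕ; fromℕ; inject₁; opposite)
open import Data.Fin.Properties as Fin using (all?; toℕ-inject₁; toℕ-fromℕ; opposite-prop)
open import Data.Integer as ℤ using (+_)
open import Data.List as List using (List; []; _∷_; length; lookup; take; filter; upTo; cartesianProductWith)
open import Data.List.Extrema.Nat using (max; max≤v⁺)
open import Data.List.Membership.Propositional using (_∈_)
open import Data.List.Membership.Propositional.Properties
  using (∈-filter⁺; ∈-filter⁻; ∈-cartesianProductWith⁺; ∈-upTo⁺)
open import Data.List.Properties using (take-all; take-suc; ∷-injective)
open import Data.List.Relation.Binary.Sublist.Propositional using (_⊆_; []; _∷_; _∷ʳ_)
open import Data.List.Relation.Unary.All as All using (All; []; _∷_)
import Data.List.Relation.Unary.All.Properties as All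
open import Data.List.Relation.Unary.Any using (here)
open import Data.List.Relation.Unary.Unique.Propositional using (Unique; []; _∷_)
import Data.List.Relation.Unary.Unique.Propositional.Properties as Unique
open import Data.Nat as ℕ using (ℕ; zero; suc; _≤_; _<_; _∸_; z≤n; s≤s)
open import Data.Nat.Properties as ℕ using (≤-refl; ≤-trans; n≤1+n; ≰⇒>; m∸[m∸n]≡n; n∸n≡0)
open import Data.Product using (∃; _×_; _,_; proj₂)
open import Data.Rational as ℚ using (ℚ; 0ℚ; 1ℚ; ½; NonZero; 1/_)
open import Data.Rational.Properties as ℚ using (*-inverseˡ; +-0-commutativeMonoid)
open import Data.Rational.Solver using (module +-*-Solver)
open import Data.Vec as Vec using (Vec; []; _∷_)
open import Function using (_∘_; _⇔_; mk⇔; Equivalence)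
open import Relation.Binary.PropositionalEquality
  using (_≡_; _≗_; refl; sym; trans; cong; cong₂; subst; module ≡-Reasoning)
open import Relation.Nullary using (¬_; Dec; yes; no; ¬?)
open import Relation.Nullary.Decidable using (map′; _×-dec_; _→-dec_)
open import Level using (0ℓ)
open import Relation.Unary using (Pred; Decidable)

open import Algebra.Properties.CommutativeMonoid.Sum +-0-commutativeMonoid
  using (sum; sum-cong-≗; sum-init-last; sum-syntax; sum⁺-syntax)

------------------------------------------------------------------------
-- Restricted growth sequences

record IsRGS (π : List ℕ) : Set where
  constructor mkRGS
  field
    positive : ∀ (i : Fin (length π)) → 1 ≤ lookup π i
    first    : ∀ (i : Fin (length π)) → toℕ i ≡ 0 → lookup π i ≡ 1
    -- With positions counted from 0, `take (suc (toℕ i)) π` is the prefix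
    -- ending at position i, which is nonempty, so the 0 given to `max`
    -- does not affect its value.
    growth   : ∀ (i j : Fin (length π)) → toℕ j ≡ suc (toℕ i) →
               lookup π j ≤ 1 ℕ.+ max 0 (take (suc (toℕ i)) π)

------------------------------------------------------------------------
-- Patterns

record OrderIsomorphic (σ τ : List ℕ) : Set where
  constructor mkOI
  field
    same-length : length σ ≡ length τ
  τ⟨_⟩ : Fin (length σ) → ℕ
  τ⟨ i ⟩ = lookup τ (Fin.cast same-length i)
  field
    same-< : ∀ i j → (lookup σ i < lookup σ j) ⇔ (τ⟨ i ⟩ < τ⟨ j ⟩)
    same-≡ : ∀ i j → (lookup σ i ≡ lookup σ j) ⇔ (τ⟨ i ⟩ ≡ τ⟨ j ⟩)

Contains : List ℕ → List ℕ → Set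
Contains π τ = ∃ λ σ → σ ⊆ π × OrderIsomorphic σ τ

Avoids : List ℕ → List ℕ → Set
Avoids π τ = ¬ Contains π τ

-- π ∈ 𝒫ₙ(B)
record 𝒫 (n : ℕ) (B : List (List ℕ)) (π : List ℕ) : Set where
  constructor mk𝒫
  field
    hasLength : length π ≡ n
    isRGS     : IsRGS π
    avoids    : All (Avoids π) B

------------------------------------------------------------------------
-- Decidability and counting

private
  ⇔-dec : ∀ {A B : Set} → Dec A → Dec B → Dec (A ⇔ B)
  ⇔-dec a b = map′ (λ (f , g) → mk⇔ f g)
                   (λ e → Equivalence.to e , Equivalence.from e)
                   ((a →-dec b) ×-dec (b →-dec a))

isRGS? : Decidable IsRGS
isRGS? π =
  map′ (λ (p , f , g) → mkRGS p f g)
       (λ r → let open IsRGS r in positive , first , growth)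
       (all? (λ i → 1 ℕ.≤? _)
        ×-dec all? (λ i → (toℕ i ℕ.≟ 0) →-dec (_ ℕ.≟ 1))
        ×-dec all? (λ i → all? λ j → (toℕ j ℕ.≟ suc (toℕ i)) →-dec (_ ℕ.≤? _)))

orderIsomorphic? : ∀ σ τ → Dec (OrderIsomorphic σ τ)
orderIsomorphic? σ τ with length σ ℕ.≟ length τ
... | no  l≢ = no (l≢ ∘ OrderIsomorphic.same-length)
... | yes l≡ =
  map′ (λ (p , q) → mkOI l≡ p q)
       (λ o → OrderIsomorphic.same-< o , OrderIsomorphic.same-≡ o)
       (all? (λ i → all? λ j → ⇔-dec (_ ℕ.<? _) (_ ℕ.<? _))
        ×-dec all? (λ i → all? λ j → ⇔-dec (_ ℕ.≟ _) (_ ℕ.≟ _)))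

private
  anySublist? : ∀ {Q : Pred (List ℕ) 0ℓ} → Decidable Q →
                ∀ π → Dec (∃ λ σ → σ ⊆ π × Q σ)
  anySublist? Q? [] =
    map′ (λ q → [] , [] , q) (λ { (_ , [] , q) → q }) (Q? [])
  anySublist? {Q} Q? (x ∷ π)
    with anySublist? {Q ∘ (x ∷_)} (Q? ∘ (x ∷_)) π | anySublist? Q? π
  ... | yes (σ , s , q) | _               = yes (x ∷ σ , refl ∷ s , q)
  ... | no _            | yes (σ , s , q) = yes (σ , x ∷ʳ s , q)
  ... | no ¬a           | no ¬b           =
    no λ { (_ , refl ∷ s , q) → ¬a (_ , s , q)
         ; (_ , _ ∷ʳ s , q)   → ¬b (_ , s , q) }

avoids? : ∀ π τ → Dec (Avoids π τ)
avoids? π τ = ¬? (anySublist? (λ σ → orderIsomorphic? σ τ) π)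

𝒫? : ∀ n B → Decidable (𝒫 n B)
𝒫? n B π = map′ (λ (l , r , a) → mk𝒫 l r a)
                (λ p → let open 𝒫 p in hasLength , isRGS , avoids)
                ((length π ℕ.≟ n) ×-dec isRGS? π ×-dec All.all? (avoids? π) B)

-- All words of length k over {0,…,n}.
words : ℕ → ℕ → List (List ℕ)
words n zero    = [] ∷ []
words n (suc k) = cartesianProductWith _∷_ (upTo (suc n)) (words n k)

-- Entries of a restricted growth sequence of length n are at most n, so this
-- list contains each element of 𝒫ₙ(B) exactly once; see 𝒫-list-unique and
-- ∈-𝒫-list below.
𝒫-list : ℕ → List (List ℕ) → List (List ℕ)
𝒫-list n B = filter (𝒫? n B) (words n n)

∣𝒫∣ : ℕ → List (List ℕ) → ℕ
∣𝒫∣ n B = length (𝒫-list n B)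

private
  prefix-bound : ∀ {π} → IsRGS π → ∀ k → All (_≤ k) (take k π)
  prefix-bound r zero = []
  prefix-bound {π} r (suc k) with suc k ℕ.≤? length π
  ... | no k≮ = subst (All (_≤ suc k))
                  (trans (take-all k π k≥) (sym (take-all (suc k) π (≤-trans k≥ (n≤1+n k)))))
                  (All.map (λ p → ≤-trans p (n≤1+n k)) (prefix-bound r k))
    where k≥ = ℕ.≤-pred (≰⇒> k≮)
  ... | yes k< = subst (λ m → All (_≤ suc k) (take (suc m) π)) j≡k
                  (subst (All (_≤ suc k)) (sym (take-suc π j))
                    (All.∷ʳ⁺ (subst (λ m → All (_≤ suc k) (take m π)) (sym j≡k)
                       (All.map (λ p → ≤-trans p (n≤1+n k)) (prefix-bound r k)))
                     (last k (prefix-bound r k) j j≡k)))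
    where
    j : Fin (length π)
    j = Fin.fromℕ< k<
    j≡k : toℕ j ≡ k
    j≡k = Fin.toℕ-fromℕ< k<
    last : ∀ k → All (_≤ k) (take k π) → ∀ j → toℕ j ≡ k → lookup π j ≤ suc k
    last zero    _ j e = subst (_≤ 1) (sym (IsRGS.first r j e)) ≤-refl
    last (suc k) b j e =
      ≤-trans (IsRGS.growth r i j (trans e (cong suc (sym i≡k))))
              (s≤s (max≤v⁺ z≤n (subst (λ m → All (_≤ suc k) (take (suc m) π)) (sym i≡k) b)))
      where
      k<′ : k < length π
      k<′ = ≤-trans (n≤1+n (suc k)) (subst (_< length π) e (Fin.toℕ<n j))
      i : Fin (length π)
      i = Fin.fromℕ< k<′
      i≡k : toℕ i ≡ k
      i≡k = Fin.toℕ-fromℕ< k<′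

  ∈-words : ∀ n π → All (_≤ n) π → π ∈ words n (length π)
  ∈-words n []      []       = here refl
  ∈-words n (x ∷ π) (p ∷ ps) =
    ∈-cartesianProductWith⁺ _∷_ (∈-upTo⁺ (s≤s p)) (∈-words n π ps)

  words-unique : ∀ n k → Unique (words n k)
  words-unique n zero    = [] ∷ []
  words-unique n (suc k) =
    Unique.cartesianProductWith⁺ _∷_ ∷-injective (Unique.upTo⁺ (suc n)) (words-unique n k)

𝒫-list-unique : ∀ n B → Unique (𝒫-list n B)
𝒫-list-unique n B = Unique.filter⁺ (𝒫? n B) (words-unique n n)

∈-𝒫-list : ∀ n B π → π ∈ 𝒫-list n B ⇔ 𝒫 n B π
∈-𝒫-list n B π = mk⇔ (proj₂ ∘ ∈-filter⁻ (𝒫? n B) {xs = words n n}) from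
  where
  from : 𝒫 n B π → π ∈ 𝒫-list n B
  from p@(mk𝒫 refl r _) =
    ∈-filter⁺ (𝒫? n B)
      (∈-words n π (subst (All (_≤ n)) (take-all n π ≤-refl) (prefix-bound r n))) p

------------------------------------------------------------------------
-- Formal power series over ℚ

-- A series is its coefficient sequence; equality of series is _≗_.
Series : Set
Series = ℕ → ℚ

fromℕₛ : ℕ → Series
fromℕₛ c zero    = + c ℚ./ 1
fromℕₛ c (suc _) = 0ℚ

X : Series
X 1 = 1ℚ
X _ = 0ℚ

infixl 6 _+ₛ_ _-ₛ_
infixl 7 _*ₛ_ _/ₛ_

_+ₛ_ _-ₛ_ _*ₛ_ : Series → Series → Series
(f +ₛ g) n = f n ℚ.+ g n
(f -ₛ g) n = f n ℚ.- g n
(f *ₛ g) n = ∑[ i ≤ n ] (f (toℕ i) ℚ.* g (n ∸ toℕ i))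

-- Long division: the quotient g / f has constant term q = g₀ / f₀, and its
-- remaining coefficients are those of ((g - q f) / X) / f.  See /ₛ-*ₛ.
_/ₛ_ : (g f : Series) .{{_ : NonZero (f 0)}} → Series
(g /ₛ f) zero    = g 0 ℚ.÷ f 0
(g /ₛ f) (suc n) = ((λ k → g (suc k) ℚ.- (g 0 ℚ.÷ f 0) ℚ.* f (suc k)) /ₛ f) n

-- sqrtCoeffs f n = sₙ ∷ … ∷ s₁ ∷ [], obtained by solving
-- fₙ₊₁ = 2 sₙ₊₁ + ∑_{1 ≤ i ≤ n} sᵢ sₙ₊₁₋ᵢ for sₙ₊₁.
sqrtCoeffs : Series → (n : ℕ) → Vec ℚ n
sqrtCoeffs f zero    = []
sqrtCoeffs f (suc n) =
  ½ ℚ.* (f (suc n) ℚ.- ∑[ i < n ] (Vec.lookup s (opposite i) ℚ.* Vec.lookup s i)) ∷ s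
  where s = sqrtCoeffs f n

-- For f with constant term 1, the square root of f with constant term 1;
-- see sqrt-*ₛ.
sqrt : (f : Series) → .(f 0 ≡ 1ℚ) → Series
sqrt f _ zero    = 1ℚ
sqrt f _ (suc n) = Vec.head (sqrtCoeffs f (suc n))

genFun : (ℕ → ℕ) → Series
genFun a n = + (a n) ℚ./ 1

/ₛ-*ₛ : ∀ g f .{{_ : NonZero (f 0)}} → (g /ₛ f) *ₛ f ≗ g
/ₛ-*ₛ g f zero = begin
  (g 0 ℚ.* 1/ f 0) ℚ.* f 0 ℚ.+ 0ℚ ≡⟨ ℚ.+-identityʳ _ ⟩
  (g 0 ℚ.* 1/ f 0) ℚ.* f 0        ≡⟨ ℚ.*-assoc (g 0) _ _ ⟩
  g 0 ℚ.* (1/ f 0 ℚ.* f 0)        ≡⟨ cong (g 0 ℚ.*_) (*-inverseˡ (f 0)) ⟩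
  g 0 ℚ.* 1ℚ                      ≡⟨ ℚ.*-identityʳ _ ⟩
  g 0                             ∎
  where open ≡-Reasoning
/ₛ-*ₛ g f (suc n) =
  trans (cong (qf ℚ.+_) (/ₛ-*ₛ (λ k → g (suc k) ℚ.- (g 0 ℚ.÷ f 0) ℚ.* f (suc k)) f n))
        (solve 2 (λ a b → a :+ (b :- a) := b) refl qf (g (suc n)))
  where
  open +-*-Solver
  qf = (g 0 ℚ.÷ f 0) ℚ.* f (suc n)

sqrt-*ₛ : ∀ f (f₀ : f 0 ≡ 1ℚ) → sqrt f f₀ *ₛ sqrt f f₀ ≗ f
sqrt-*ₛ f f₀ zero    = sym f₀
sqrt-*ₛ f f₀ (suc n) = begin
  1ℚ ℚ.* s (suc n) ℚ.+ sum t
    ≡⟨ cong (1ℚ ℚ.* s (suc n) ℚ.+_) (sum-init-last t) ⟩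
  1ℚ ℚ.* s (suc n) ℚ.+ (sum {n} (λ i → t (inject₁ i)) ℚ.+ t (fromℕ n))
    ≡⟨ cong (1ℚ ℚ.* s (suc n) ℚ.+_) (cong₂ ℚ._+_ (sum-cong-≗ {n} middle) end) ⟩
  1ℚ ℚ.* s (suc n) ℚ.+ (m ℚ.+ s (suc n) ℚ.* 1ℚ)
    ≡⟨ solve 2 (λ a b → let c = con ½ :* (a :- b) in
                        con 1ℚ :* c :+ (b :+ c :* con 1ℚ) := a) refl (f (suc n)) m ⟩
  f (suc n) ∎
  where
  open ≡-Reasoning
  open +-*-Solver
  s : Series
  s = sqrt f f₀
  v = sqrtCoeffs f n
  m : ℚ
  m = ∑[ i < n ] (Vec.lookup v (opposite i) ℚ.* Vec.lookup v i)
  t : Fin (suc n) → ℚ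
  t i = s (suc (toℕ i)) ℚ.* s (n ∸ toℕ i)
  coeff : ∀ n (i : Fin n) → Vec.lookup (sqrtCoeffs f n) i ≡ s (n ∸ toℕ i)
  coeff (suc n) zero    = refl
  coeff (suc n) (suc i) = coeff n i
  middle : ∀ i → t (inject₁ i) ≡ Vec.lookup v (opposite i) ℚ.* Vec.lookup v i
  middle i rewrite toℕ-inject₁ i | coeff n (opposite i) | coeff n i
                 | opposite-prop i | m∸[m∸n]≡n (Fin.toℕ<n i) = refl
  end : t (fromℕ n) ≡ s (suc n) ℚ.* 1ℚ
  end rewrite toℕ-fromℕ n | n∸n≡0 n = refl

{-# OPTIONS --safe #-}
module Submission where

-- In a restricted growth sequence the first occurrence of a letter c is
-- preceded by 1, ..., c - 1.  So if some c ≥ 3 occurs on both sides of a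
-- smaller letter d, then 1 2 c 1 c (if d = 1) or 1 d c d c (if d ≥ 2) is an
-- occurrence of one of the two patterns; conversely the last three letters of
-- an occurrence of either pattern are c d c with d < c and c ≥ 3.  Avoiding both patterns therefore means
-- that no c ≥ 3 is used again once a smaller letter has followed it
-- (avoids⇒valleyFree, valleyFree⇒avoids).
--
-- Read such a sequence from left to right and call a letter c ≥ 3 live if it
-- has occurred and may still be used again.  The live letters form a stack.
-- The next letter is a new maximum, which is pushed; or a live letter, which
-- removes everything above it; or 1 or 2, which empties the stack.  Once the
-- maximum is at least 2, the number of ways to append n letters depends only
-- on n and the height k of the stack, and Pascal's rule shows that it is
-- C(2n+k+1, n) (length-completions).  Hence the number aₙ of sequences satisfies
-- a₀ = a₁ = 1 and aₙ₊₂ = aₙ₊₁ + C(2n+1, n) (∣𝒫∣-step).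
--
-- On the side of power series, let B be the series of the central binomial
-- coefficients, u = 1 - 4X, S the square root of u, and θ = X d/dX.  From
-- u·θB = 2X·B, S·S = u and θu = -4X follows 2u·θ(BS) = BS·(4X + θ(SS)) = 0,
-- so BS is constant, and B = 1/S (1/√1-4X).  As 2 C(2n+1, n) = C(2n+2, n+1), the
-- recurrence for aₙ says that 2(1 - X) times the generating function is
-- 2 + X·(B - 1), which is also 2(1 - X) times the right-hand side.

open import Defs
open import Algebra.Bundles using (CommutativeRing)
import Algebra.Properties.Ring
import Algebra.Properties.Semiring.Sum
import Algebra.Solver.Ring.NaturalCoefficients.Default
open import Data.Fin as Fin using (Fin; zero; suc; toℕ; inject₁; #_)
open import Data.Fin.Properties using (toℕ-inject₁; toℕ≤pred[n])
import Data.Integer as ℤ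
import Data.Integer.Properties as ℤ
open import Data.List using (List; []; _∷_; _++_; [_]; length; lookup; map; concatMap; take)
open import Data.List.Extrema.Nat using (max; max≤v⁺; ⊥≤max; xs≤max)
open import Data.List.Membership.Propositional using (_∈_; _∉_; find; lose)
open import Data.List.Membership.Propositional.Properties
  using (∈-++⁺ˡ; ∈-++⁺ʳ; ∈-map⁺; ∈-map⁻; ∈-concatMap⁺; ∈-concatMap⁻)
open import Data.List.Membership.Propositional.Properties.WithK using (unique∧set⇒bag)
open import Data.List.Properties
  using (length-map; length-++; map-++; map-cong; ∷-injective; ∷-injectiveˡ)
open import Data.List.Relation.Binary.BagAndSetEquality using (∼bag⇒↭)
open import Data.List.Relation.Binary.Disjoint.Propositional using (Disjoint)
open import Data.List.Relation.Binary.Permutation.Propositional.Properties using (↭-length)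
open import Data.List.Relation.Binary.Sublist.Propositional
  using (_⊆_; []; _∷_; _∷ʳ_; minimum; ⊆-refl; ⊆-trans; to∈; from∈)
open import Data.List.Relation.Unary.All as All using (All; []; _∷_)
import Data.List.Relation.Unary.All.Properties as All
open import Data.List.Relation.Unary.AllPairs as AllPairs using (AllPairs; []; _∷_)
import Data.List.Relation.Unary.AllPairs.Properties as AllPairs
open import Data.List.Relation.Unary.Any using (here; there)
open import Data.List.Relation.Unary.Unique.Propositional using (Unique)
import Data.List.Relation.Unary.Unique.Propositional.Properties as Unique
open import Data.Nat
  using (ℕ; zero; suc; _+_; _*_; _∸_; _≤_; _<_; _>_; _⊔_; z≤n; s≤s; _≤?_; _≟_)
open import Data.Nat.Combinatorics using (_C_; nCk+nC[k+1]≡[n+1]C[k+1]; nCk≡nC[n∸k]; nC1≡n)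
open import Data.Nat.ListAction using (sum)
open import Data.Nat.ListAction.Properties using (sum-++)
open import Data.Nat.Properties
open import Data.Nat.Solver using () renaming (module +-*-Solver to ℕ-Solver)
open import Data.Product using (∃; _×_; _,_; proj₁; proj₂)
open import Data.Rational as ℚ using (ℚ; 0ℚ; 1ℚ; NonZero; 1/_; toℚᵘ)
import Data.Rational.Properties as ℚ
open import Data.Rational.Solver using () renaming (module +-*-Solver to ℚ-Solver)
open import Data.Rational.Unnormalised as ℚᵘ using (mkℚᵘ; *≡*)
import Data.Rational.Unnormalised.Properties as ℚᵘ
open import Data.Sum using (_⊎_; inj₁; inj₂)
open import Function using (_∘_; _⇔_; mk⇔; Equivalence)
open import Level using (0ℓ)
open import Relation.Binary.Definitions using (tri<; tri≈; tri>)
open import Relation.Binary.PropositionalEquality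
  using (_≡_; _≗_; refl; sym; trans; cong; cong₂; subst; subst₂; module ≡-Reasoning)
import Relation.Binary.Reasoning.Setoid
open import Relation.Nullary using (¬_; yes; no; contradiction)
open import Data.List.Membership.DecPropositional _≟_ using (_∈?_)

------------------------------------------------------------------------
-- Restricted growth letter by letter

-- Growth m w: a restricted growth sequence with maximum m remains one when w
-- is appended to it; m = 0 stands for the empty sequence.
data Growth (m : ℕ) : List ℕ → Set where
  []  : Growth m []
  _∷_ : ∀ {x w} → 1 ≤ x × x ≤ suc m → Growth (m ⊔ x) w → Growth m (x ∷ w)

max-∷ : ∀ m x w → max (m ⊔ x) w ≡ max m (x ∷ w)
max-∷ m x w = ≤-antisym
  (max≤v⁺ (⊔-lub (⊥≤max m (x ∷ w)) (All.head bounded)) (All.tail bounded))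
  (max≤v⁺ (≤-trans (m≤m⊔n m x) base) (≤-trans (m≤n⊔m m x) base ∷ xs≤max (m ⊔ x) w))
  where
  bounded = xs≤max m (x ∷ w)
  base    = ⊥≤max (m ⊔ x) w

Growth⇒bounds : ∀ {m w} → Growth m w → (i : Fin (length w)) →
                1 ≤ lookup w i × lookup w i ≤ suc (max m (take (toℕ i) w))
Growth⇒bounds (p ∷ g) zero = p
Growth⇒bounds {m} {x ∷ w} (p ∷ g) (suc i) with Growth⇒bounds g i
... | lo , hi = lo , subst (λ k → lookup w i ≤ suc k) (max-∷ m x (take (toℕ i) w)) hi

bounds⇒Growth : ∀ {m} w →
                (∀ i → 1 ≤ lookup w i × lookup w i ≤ suc (max m (take (toℕ i) w))) →
                Growth m w
bounds⇒Growth []          b = []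
bounds⇒Growth {m} (x ∷ w) b = b zero ∷ bounds⇒Growth w λ i →
  proj₁ (b (suc i)) ,
  subst (λ k → lookup w i ≤ suc k) (sym (max-∷ m x (take (toℕ i) w))) (proj₂ (b (suc i)))

IsRGS⇒Growth : ∀ {π} → IsRGS π → Growth 0 π
IsRGS⇒Growth {π} r = bounds⇒Growth π λ i → positive i , upper π first growth i
  where
  open IsRGS r
  upper : ∀ π → (∀ (i : Fin (length π)) → toℕ i ≡ 0 → lookup π i ≡ 1) →
          (∀ (i j : Fin (length π)) → toℕ j ≡ suc (toℕ i) →
             lookup π j ≤ suc (max 0 (take (suc (toℕ i)) π))) →
          ∀ i → lookup π i ≤ suc (max 0 (take (toℕ i) π))
  upper (x ∷ w) f g zero    = ≤-reflexive (f zero refl)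
  upper (x ∷ w) f g (suc i) =
    subst (λ k → lookup w i ≤ suc (max 0 (x ∷ take k w))) (toℕ-inject₁ i)
      (g (inject₁ i) (suc i) (cong suc (sym (toℕ-inject₁ i))))

Growth⇒IsRGS : ∀ {π} → Growth 0 π → IsRGS π
Growth⇒IsRGS {π} g = mkRGS (proj₁ ∘ b)
  (λ i i≡0 → ≤-antisym
     (subst (λ k → lookup π i ≤ suc (max 0 (take k π))) i≡0 (proj₂ (b i)))
     (proj₁ (b i)))
  (λ i j j≡ → subst (λ k → lookup π j ≤ suc (max 0 (take k π))) j≡ (proj₂ (b j)))
  where b = Growth⇒bounds g

Growth⇒positive : ∀ {m w x} → Growth m w → x ∈ w → 1 ≤ x
Growth⇒positive (p ∷ g) (here refl)  = proj₁ p
Growth⇒positive (p ∷ g) (there x∈w) = Growth⇒positive g x∈w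

-- Each letter strictly between the maximum m and a later letter x occurs
-- before x.
insert-smaller : ∀ {m w a x τ} → Growth m w → m < a → a < x →
                 x ∷ τ ⊆ w → a ∷ x ∷ τ ⊆ w
insert-smaller {a = a} {x} (_∷_ {y} (_ , y≤1+m) g) m<a a<x sub with y ≟ a
insert-smaller (_ ∷ _) m<a a<x (refl ∷ sub) | yes refl = contradiction refl (<⇒≢ a<x ∘ sym)
insert-smaller (_ ∷ _) m<a a<x (_ ∷ʳ sub)   | yes refl = refl ∷ sub
... | no y≢a = go sub
  where
  -- The letter y exceeds m by at most 1, so it cannot jump over a.
  y<a = ≤∧≢⇒< (≤-trans y≤1+m m<a) y≢a
  go : ∀ {τ} → x ∷ τ ⊆ y ∷ _ → a ∷ x ∷ τ ⊆ y ∷ _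
  go (refl ∷ sub) = contradiction (<-trans y<a a<x) (<-irrefl refl)
  go (_ ∷ʳ sub)   = y ∷ʳ insert-smaller g (⊔-pres-<m m<a y<a) a<x sub

------------------------------------------------------------------------
-- The two patterns as a condition on valleys

p12313 p12323 : List ℕ
p12313 = 1 ∷ 2 ∷ 3 ∷ 1 ∷ 3 ∷ []
p12323 = 1 ∷ 2 ∷ 3 ∷ 2 ∷ 3 ∷ []

-- No letter c ≥ 3 occurs on both sides of a smaller letter.
ValleyFree : List ℕ → Set
ValleyFree w = ∀ {c d} → 3 ≤ c → d < c → ¬ (c ∷ d ∷ c ∷ [] ⊆ w)

lookup-map : ∀ (f : ℕ → ℕ) τ i →
             lookup (map f τ) i ≡ f (lookup τ (Fin.cast (length-map f τ) i))
lookup-map f (x ∷ τ) zero    = refl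
lookup-map f (x ∷ τ) (suc i) = lookup-map f τ i

map-orderIsomorphic : ∀ {f} → (∀ {a b} → a < b → f a < f b) →
                      ∀ τ → OrderIsomorphic (map f τ) τ
map-orderIsomorphic {f} mono τ = mkOI (length-map f τ)
  (λ i j → mk⇔ (λ p → reflect (subst₂ _<_ (lookup-map f τ i) (lookup-map f τ j) p))
               (λ p → subst₂ _<_ (sym (lookup-map f τ i)) (sym (lookup-map f τ j)) (mono p)))
  (λ i j → mk⇔ (λ p → injective (trans (sym (lookup-map f τ i)) (trans p (lookup-map f τ j))))
               (λ p → trans (lookup-map f τ i) (trans (cong f p) (sym (lookup-map f τ j)))))
  where
  reflect : ∀ {a b} → f a < f b → a < b
  reflect {a} {b} p with <-cmp a b
  ... | tri< a<b _ _  = a<b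
  ... | tri≈ _ refl _ = contradiction p (<-irrefl refl)
  ... | tri> _ _ b<a  = contradiction (mono b<a) (<-asym p)
  injective : ∀ {a b} → f a ≡ f b → a ≡ b
  injective {a} {b} e with <-cmp a b
  ... | tri< a<b _ _ = contradiction (mono a<b) (<-irrefl e)
  ... | tri≈ _ a≡b _ = a≡b
  ... | tri> _ _ b<a = contradiction (mono b<a) (<-irrefl (sym e))

-- For 1 < b < c, a strictly increasing map with 1 ↦ 1, 2 ↦ b and 3 ↦ c.
stretch : ℕ → ℕ → ℕ → ℕ
stretch b c 0                   = 0
stretch b c 1                   = 1
stretch b c 2                   = b
stretch b c (suc (suc (suc n))) = n + c

stretch-mono : ∀ {b c} → 1 < b → b < c → ∀ {i j} → i < j → stretch b c i < stretch b c j
stretch-mono {b} {c} 1<b b<c = mono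
  where
  step : ∀ i → stretch b c i < stretch b c (suc i)
  step 0                   = s≤s z≤n
  step 1                   = 1<b
  step 2                   = b<c
  step (suc (suc (suc n))) = ≤-refl
  mono : ∀ {i j} → i < j → stretch b c i < stretch b c j
  mono {i} {suc j} i<1+j with i ≟ j
  ... | yes refl = step i
  ... | no  i≢j  = <-trans (mono (≤∧≢⇒< (≤-pred i<1+j) i≢j)) (step j)

-- A valley c d c extends to the left to 1 2 c 1 c if d = 1, and to 1 d c d c
-- otherwise.
avoids⇒valleyFree : ∀ {π} → Growth 0 π → Avoids π p12313 → Avoids π p12323 → ValleyFree π
avoids⇒valleyFree {π} g avoid₁ avoid₂ {c} {d} 3≤c d<c sub with d ≟ 1
... | yes refl = avoid₁
  ( _ , insert-smaller g (s≤s z≤n) ≤-refl (insert-smaller g (s≤s z≤n) 3≤c sub)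
  , map-orderIsomorphic (stretch-mono ≤-refl 3≤c) p12313)
... | no d≢1   = avoid₂
  ( _ , insert-smaller g (s≤s z≤n) 1<d (insert-smaller g (<-trans (s≤s z≤n) 1<d) d<c sub)
  , map-orderIsomorphic (stretch-mono 1<d d<c) p12323)
  where
  1<d : 1 < d
  1<d = ≤∧≢⇒< (Growth⇒positive g (to∈ (⊆-trans (c ∷ʳ refl ∷ minimum _) sub))) (d≢1 ∘ sym)

-- An occurrence p q r s r has 1 ≤ p < q < r, so r ≥ 3 and r s r is a valley.
valleyFree⇒avoids : ∀ {π} → Growth 0 π → ValleyFree π → ∀ {s} → s < 3 →
                    Avoids π (1 ∷ 2 ∷ 3 ∷ s ∷ 3 ∷ [])
valleyFree⇒avoids g vf s<3 (p ∷ q ∷ r ∷ s ∷ t ∷ [] , sub , oi) with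
  Equivalence.from (OrderIsomorphic.same-≡ oi (# 4) (# 2)) refl
... | refl = vf 3≤r s<r (⊆-trans (p ∷ʳ q ∷ʳ ⊆-refl) sub)
  where
  open OrderIsomorphic oi
  p<q = Equivalence.from (same-< (# 0) (# 1)) (s≤s (s≤s z≤n))
  q<r = Equivalence.from (same-< (# 1) (# 2)) (s≤s (s≤s (s≤s z≤n)))
  s<r = Equivalence.from (same-< (# 3) (# 2)) s<3
  1≤p = Growth⇒positive g (to∈ (⊆-trans (refl ∷ minimum _) sub))
  3≤r = ≤-trans (s≤s (≤-trans (s≤s 1≤p) p<q)) q<r
valleyFree⇒avoids g vf s<3 ([] , _ , mkOI () _ _)
valleyFree⇒avoids g vf s<3 (_ ∷ [] , _ , mkOI () _ _)
valleyFree⇒avoids g vf s<3 (_ ∷ _ ∷ [] , _ , mkOI () _ _)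
valleyFree⇒avoids g vf s<3 (_ ∷ _ ∷ _ ∷ [] , _ , mkOI () _ _)
valleyFree⇒avoids g vf s<3 (_ ∷ _ ∷ _ ∷ _ ∷ [] , _ , mkOI () _ _)
valleyFree⇒avoids g vf s<3 (_ ∷ _ ∷ _ ∷ _ ∷ _ ∷ _ ∷ _ , _ , mkOI () _ _)

------------------------------------------------------------------------
-- Completions and the stack of live letters

-- The words w that may follow a valley-free prefix with maximum m and live
-- letters s.  A letter c ≥ 3 of the prefix is live if no smaller letter has
-- followed it, and dead otherwise.
record Completion (m : ℕ) (s w : List ℕ) : Set where
  constructor mkCompletion
  field
    growth     : Growth m w
    valleyFree : ValleyFree w
    live       : ∀ {c d} → c ∈ s → d < c → ¬ (d ∷ c ∷ [] ⊆ w)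
    dead       : ∀ {c} → 3 ≤ c → c ≤ m → c ∉ s → c ∉ w

-- The letter x may come next, and it changes the live letters from s to t:
-- x becomes live if x ≥ 3, and everything above x dies.
record Move (m : ℕ) (s : List ℕ) (x : ℕ) (t : List ℕ) : Set where
  constructor mkMove
  field
    bounds  : 1 ≤ x × x ≤ suc m
    allowed : 3 ≤ x → x ≤ m → x ∈ s
    kept    : ∀ {c} → c ∈ t → 3 ≤ c × (c ∈ s ⊎ c ≡ x) × c ≤ x
    keeps   : ∀ {c} → 3 ≤ c → c ∈ s ⊎ c ≡ x → c ≤ x → c ∈ t

-- Live letters are listed from the top of the stack, the largest first.
record Stack (m : ℕ) (s : List ℕ) : Set where
  constructor mkStack
  field
    decreasing : AllPairs _>_ s
    range      : All (λ c → 3 ≤ c × c ≤ m) s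

Stack-[] : ∀ {m} → Stack m []
Stack-[] = mkStack [] []

Completion-tail : ∀ {m s x t w} → Move m s x t →
                  Completion m s (x ∷ w) → Completion (m ⊔ x) t w
Completion-tail {m} {s} {x} {t} {w} mv (mkCompletion (_ ∷ g) vf lv dd) =
  mkCompletion g (λ 3≤c d<c sub → vf 3≤c d<c (x ∷ʳ sub)) live′ dead′
  where
  open Move mv
  live′ : ∀ {c d} → c ∈ t → d < c → ¬ (d ∷ c ∷ [] ⊆ w)
  live′ c∈t d<c sub with kept c∈t
  ... | _   , inj₁ c∈s  , _ = lv c∈s d<c (x ∷ʳ sub)
  ... | 3≤c , inj₂ refl , _ = vf 3≤c d<c (refl ∷ sub)
  dead′ : ∀ {c} → 3 ≤ c → c ≤ m ⊔ x → c ∉ t → c ∉ w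
  dead′ {c} 3≤c c≤m⊔x c∉t c∈w with c ∈? s | c ≤? x | c ≤? m
  ... | yes c∈s | yes c≤x | _       = c∉t (keeps 3≤c (inj₁ c∈s) c≤x)
  ... | yes c∈s | no  c≰x | _       = lv c∈s (≰⇒> c≰x) (refl ∷ from∈ c∈w)
  ... | no  c∉s | _       | yes c≤m = dd 3≤c c≤m c∉s (there c∈w)
  -- Here m < c ≤ x ≤ m + 1, so c is the new maximum x itself.
  ... | no  c∉s | yes c≤x | no  c≰m =
    c∉t (keeps 3≤c (inj₂ (≤-antisym c≤x (≤-trans (proj₂ bounds) (≰⇒> c≰m)))) c≤x)
  ... | no  c∉s | no  c≰x | no  c≰m =
    contradiction c≤m⊔x (<⇒≱ (⊔-pres-<m (≰⇒> c≰m) (≰⇒> c≰x)))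

Completion-∷ : ∀ {m s x t w} → Stack m s → Move m s x t →
               Completion (m ⊔ x) t w → Completion m s (x ∷ w)
Completion-∷ {m} {s} {x} {t} {w} st mv (mkCompletion g vf lv dd) =
  mkCompletion (bounds ∷ g) vf′ live′ dead′
  where
  open Move mv
  dropped : ∀ {c} → c ∈ s → x < c → c ∉ w
  dropped c∈s x<c with All.lookup (Stack.range st) c∈s
  ... | 3≤c , c≤m = dd 3≤c (≤-trans c≤m (m≤m⊔n m x))
                       (λ c∈t → <⇒≱ x<c (proj₂ (proj₂ (kept c∈t))))
  x∈t : 3 ≤ x → x ∈ t
  x∈t 3≤x = keeps 3≤x (inj₂ refl) ≤-refl
  vf′ : ValleyFree (x ∷ w)
  vf′ 3≤c d<c (_ ∷ʳ sub)   = vf 3≤c d<c sub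
  vf′ 3≤c d<c (refl ∷ sub) = lv (x∈t 3≤c) d<c sub
  live′ : ∀ {c d} → c ∈ s → d < c → ¬ (d ∷ c ∷ [] ⊆ x ∷ w)
  live′ c∈s d<c (refl ∷ sub) = dropped c∈s d<c (to∈ sub)
  live′ {c} {d} c∈s d<c (_ ∷ʳ sub) with c ≤? x
  ... | yes c≤x = lv (keeps (proj₁ (All.lookup (Stack.range st) c∈s)) (inj₁ c∈s) c≤x) d<c sub
  ... | no  c≰x = dropped c∈s (≰⇒> c≰x) (to∈ (⊆-trans (d ∷ʳ ⊆-refl) sub))
  dead′ : ∀ {c} → 3 ≤ c → c ≤ m → c ∉ s → c ∉ x ∷ w
  dead′ 3≤c c≤m c∉s (here refl) = c∉s (allowed 3≤c c≤m)
  dead′ {c} 3≤c c≤m c∉s (there c∈w) with c ∈? t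
  ... | no  c∉t = dd 3≤c (≤-trans c≤m (m≤m⊔n m x)) c∉t c∈w
  ... | yes c∈t with kept c∈t
  ...   | _ , inj₁ c∈s  , _ = c∉s c∈s
  ...   | _ , inj₂ refl , _ = c∉s (allowed 3≤c c≤m)

------------------------------------------------------------------------
-- The moves

-- The stack after the new maximum suc m; a new letter below 3 is not recorded.
push : ℕ → List ℕ → List ℕ
push (suc (suc m)) s = suc (suc (suc m)) ∷ s
push _             s = s

-- Moves to a live letter, each listed as the letter and the resulting stack.
returns : List ℕ → List (ℕ × List ℕ)
returns []      = []
returns (c ∷ s) = (c , c ∷ s) ∷ returns s

-- Moves to a letter 1 or 2 that does not exceed the maximum.
smalls : ℕ → List (ℕ × List ℕ)
smalls 0             = []
smalls 1             = (1 , []) ∷ []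
smalls (suc (suc _)) = (2 , []) ∷ (1 , []) ∷ []

moves : ℕ → List ℕ → List (ℕ × List ℕ)
moves m s = (suc m , push m s) ∷ returns s ++ smalls m

Legal : ℕ → List ℕ → ℕ × List ℕ → Set
Legal m s (x , t) = Move m s x t × Stack (m ⊔ x) t

-- The letter x is in s, and t is the part of s from x downwards.
Return : ℕ → List ℕ → ℕ × List ℕ → Set
Return m s (x , t) = x ∈ s × Stack m t × (∀ c → c ∈ t ⇔ (c ∈ s × c ≤ x))

push-legal : ∀ m {s} → Stack m s → Legal m s (suc m , push m s)
push-legal m {s} st =
  mkMove (s≤s z≤n , ≤-refl) (λ _ 1+m≤m → contradiction 1+m≤m (<-irrefl refl))
         (kept m (Stack.range st)) (keeps m) ,
  subst (λ k → Stack k (push m s)) (sym (m≤n⇒m⊔n≡n (n≤1+n m))) (stack m st)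
  where
  old : ∀ {m c} → All (λ c → 3 ≤ c × c ≤ m) s → c ∈ s →
        3 ≤ c × (c ∈ s ⊎ c ≡ suc m) × c ≤ suc m
  old r c∈s = let 3≤c , c≤m = All.lookup r c∈s in 3≤c , inj₁ c∈s , m≤n⇒m≤1+n c≤m
  kept : ∀ m {c} → All (λ c → 3 ≤ c × c ≤ m) s → c ∈ push m s →
         3 ≤ c × (c ∈ s ⊎ c ≡ suc m) × c ≤ suc m
  kept 0             r c∈s         = old r c∈s
  kept 1             r c∈s         = old r c∈s
  kept (suc (suc m)) r (here refl) = s≤s (s≤s (s≤s z≤n)) , inj₂ refl , ≤-refl
  kept (suc (suc m)) r (there c∈s) = old r c∈s
  keeps : ∀ m {c} → 3 ≤ c → c ∈ s ⊎ c ≡ suc m → c ≤ suc m → c ∈ push m s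
  keeps 0             3≤c (inj₁ c∈s)  _ = c∈s
  keeps 1             3≤c (inj₁ c∈s)  _ = c∈s
  keeps 0             3≤c (inj₂ refl) _ = contradiction 3≤c λ { (s≤s ()) }
  keeps 1             3≤c (inj₂ refl) _ = contradiction 3≤c λ { (s≤s (s≤s ())) }
  keeps (suc (suc m)) 3≤c (inj₁ c∈s)  _ = there c∈s
  keeps (suc (suc m)) 3≤c (inj₂ refl) _ = here refl
  raise : ∀ {m s} → All (λ c → 3 ≤ c × c ≤ m) s → All (λ c → 3 ≤ c × c ≤ suc m) s
  raise = All.map λ (p , q) → p , m≤n⇒m≤1+n q
  stack : ∀ m {s} → Stack m s → Stack (suc m) (push m s)
  stack 0             (mkStack d r) = mkStack d (raise r)
  stack 1             (mkStack d r) = mkStack d (raise r)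
  stack (suc (suc m)) (mkStack d r) =
    mkStack (All.map (s≤s ∘ proj₂) r ∷ d) ((s≤s (s≤s (s≤s z≤n)) , ≤-refl) ∷ raise r)

returns-return : ∀ {m s} → Stack m s → All (Return m s) (returns s)
returns-return {s = []}        _                             = []
returns-return {m} {s = a ∷ s} st@(mkStack (a> ∷ d) (_ ∷ r)) =
  (here refl , st , λ c → mk⇔ (λ i → i , bound i) proj₁) ∷
  All.map extend (returns-return (mkStack d r))
  where
  bound : ∀ {c} → c ∈ a ∷ s → c ≤ a
  bound (here refl) = ≤-refl
  bound (there i)   = <⇒≤ (All.lookup a> i)
  extend : ∀ {p} → Return m s p → Return m (a ∷ s) p
  extend (x∈s , st′ , f) = there x∈s , st′ , λ c → mk⇔
    (λ i → let j , c≤x = Equivalence.to (f c) i in there j , c≤x)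
    λ { (here refl , c≤x) → contradiction c≤x (<⇒≱ (All.lookup a> x∈s))
      ; (there j   , c≤x) → Equivalence.from (f c) (j , c≤x) }

return-legal : ∀ {m s p} → Stack m s → Return m s p → Legal m s p
return-legal {p = x , t} st (x∈s , st′ , f) =
  mkMove (≤-trans (s≤s z≤n) 3≤x , m≤n⇒m≤1+n x≤m) (λ _ _ → x∈s)
    (λ c∈t → let c∈s , c≤x = Equivalence.to (f _) c∈t
             in proj₁ (All.lookup (Stack.range st) c∈s) , inj₁ c∈s , c≤x)
    (λ { _ (inj₁ c∈s)  c≤x → Equivalence.from (f _) (c∈s , c≤x)
       ; _ (inj₂ refl) c≤x → Equivalence.from (f _) (x∈s , c≤x) }) ,
  subst (λ k → Stack k t) (sym (m≥n⇒m⊔n≡m x≤m)) st′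
  where
  3≤x = proj₁ (All.lookup (Stack.range st) x∈s)
  x≤m = proj₂ (All.lookup (Stack.range st) x∈s)

small-legal : ∀ {m s x} → 1 ≤ x → x < 3 → x ≤ m → Legal m s (x , [])
small-legal 1≤x x<3 x≤m =
  mkMove (1≤x , m≤n⇒m≤1+n x≤m) (λ 3≤x → contradiction x<3 (≤⇒≯ 3≤x)) (λ ())
    (λ 3≤c _ c≤x → contradiction x<3 (≤⇒≯ (≤-trans 3≤c c≤x))) ,
  Stack-[]

moves-legal : ∀ m {s} → Stack m s → All (Legal m s) (moves m s)
moves-legal m st =
  push-legal m st ∷ All.++⁺ (All.map (return-legal st) (returns-return st)) (small m)
  where
  small : ∀ m {s} → All (Legal m s) (smalls m)
  small 0             = []
  small 1             = small-legal ≤-refl (s≤s (s≤s z≤n)) ≤-refl ∷ []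
  small (suc (suc m)) = small-legal (s≤s z≤n) ≤-refl (s≤s (s≤s z≤n)) ∷
                        small-legal ≤-refl (s≤s (s≤s z≤n)) (s≤s z≤n) ∷ []

smalls-bounded : ∀ m → All (λ (x , _) → x ≤ m × x < 3) (smalls m)
smalls-bounded 0             = []
smalls-bounded 1             = (≤-refl , s≤s (s≤s z≤n)) ∷ []
smalls-bounded (suc (suc m)) = (s≤s (s≤s z≤n) , ≤-refl) ∷ (s≤s z≤n , s≤s (s≤s z≤n)) ∷ []

-- In particular, different moves play different letters.
moves-decreasing : ∀ m {s} → Stack m s → AllPairs (λ p q → proj₁ p > proj₁ q) (moves m s)
moves-decreasing m {s} st =
  All.++⁺ (All.map (λ (x∈s , _) → s≤s (proj₂ (All.lookup (Stack.range st) x∈s))) rs)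
          (All.map (s≤s ∘ proj₁) (smalls-bounded m))
  ∷ AllPairs.++⁺ (return st) (small m) (All.map above rs)
  where
  rs = returns-return st
  above : ∀ {p} → Return m s p → All (λ q → proj₁ p > proj₁ q) (smalls m)
  above (x∈s , _) =
    All.map (λ (_ , y<3) → ≤-trans y<3 (proj₁ (All.lookup (Stack.range st) x∈s))) (smalls-bounded m)
  return : ∀ {s} → Stack m s → AllPairs (λ p q → proj₁ p > proj₁ q) (returns s)
  return {[]}    _                          = []
  return {c ∷ s} (mkStack (c> ∷ d) (_ ∷ r)) =
    All.map (λ (x∈s , _) → All.lookup c> x∈s) (returns-return (mkStack d r)) ∷ return (mkStack d r)
  small : ∀ m → AllPairs (λ p q → proj₁ p > proj₁ q) (smalls m)
  small 0             = []
  small 1             = [] ∷ []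
  small (suc (suc m)) = (≤-refl ∷ []) ∷ [] ∷ []

moves-complete : ∀ {m s x} → 1 ≤ x → x ≤ suc m → (3 ≤ x → x ≤ m → x ∈ s) →
                 ∃ λ t → (x , t) ∈ moves m s
moves-complete {m} {s} {x} 1≤x x≤1+m allowed with x ≟ suc m | 3 ≤? x
... | yes refl | _ = push m s , here refl
... | no x≢    | yes 3≤x =
  let t , i = return s (allowed 3≤x (≤-pred (≤∧≢⇒< x≤1+m x≢))) in t , there (∈-++⁺ˡ i)
  where
  return : ∀ s → x ∈ s → ∃ λ t → (x , t) ∈ returns s
  return (c ∷ s) (here refl) = c ∷ s , here refl
  return (c ∷ s) (there i)   = let t , j = return s i in t , there j
... | no x≢    | no 3≰x =
  [] , there (∈-++⁺ʳ (returns s) (small x m 1≤x (≰⇒> 3≰x) (≤-pred (≤∧≢⇒< x≤1+m x≢))))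
  where
  small : ∀ x m → 1 ≤ x → x < 3 → x ≤ m → (x , []) ∈ smalls m
  small 1 1             _ _ _ = here refl
  small 1 (suc (suc m)) _ _ _ = there (here refl)
  small 2 (suc (suc m)) _ _ _ = here refl
  small 2 1 _ _ (s≤s ())
  small (suc (suc (suc _))) _ _ (s≤s (s≤s (s≤s ()))) _

------------------------------------------------------------------------
-- Enumeration of the avoiding sequences

-- All completions of length n, for a prefix with maximum m and live letters s.
completions : ℕ → ℕ → List ℕ → List (List ℕ)
completions zero    m s = [ [] ]
completions (suc n) m s =
  concatMap (λ (x , t) → map (x ∷_) (completions n (m ⊔ x) t)) (moves m s)

∈-completions⁻ : ∀ n {m s w} → Stack m s → w ∈ completions n m s →
                 length w ≡ n × Completion m s w
∈-completions⁻ zero st (here refl) = refl , mkCompletion [] (λ _ _ ()) (λ _ _ ()) (λ _ _ _ ())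
∈-completions⁻ (suc n) {m} {s} st w∈ with find (∈-concatMap⁻ _ {xs = moves m s} w∈)
... | (x , t) , p∈ , w∈′ with ∈-map⁻ (x ∷_) w∈′
... | w , w∈″ , refl =
  let mv , st′ = All.lookup (moves-legal m st) p∈
      e , c    = ∈-completions⁻ n st′ w∈″
  in cong suc e , Completion-∷ st mv c

∈-completions⁺ : ∀ {m s} w → Stack m s → Completion m s w → w ∈ completions (length w) m s
∈-completions⁺ []              st c = here refl
∈-completions⁺ {m} {s} (x ∷ w) st c@(mkCompletion ((1≤x , x≤1+m) ∷ _) _ _ dead) with
  moves-complete {s = s} 1≤x x≤1+m allowed
  where
  allowed : 3 ≤ x → x ≤ m → x ∈ s
  allowed 3≤x x≤m with x ∈? s
  ... | yes x∈s = x∈s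
  ... | no  x∉s = contradiction (here refl) (dead 3≤x x≤m x∉s)
... | t , p∈ =
  let mv , st′ = All.lookup (moves-legal m st) p∈
  in ∈-concatMap⁺ _ {xs = moves m s}
       (lose p∈ (∈-map⁺ (x ∷_) (∈-completions⁺ w st′ (Completion-tail mv c))))

completions-unique : ∀ n {m s} → Stack m s → Unique (completions n m s)
completions-unique zero        st = [] ∷ []
completions-unique (suc n) {m} st = Unique.concat⁺
  (All.map⁺ (All.map (λ (_ , st′) → Unique.map⁺ (proj₂ ∘ ∷-injective) (completions-unique n st′))
                     (moves-legal m st)))
  (AllPairs.map⁺ (AllPairs.map disjoint (moves-decreasing m st)))
  where
  disjoint : ∀ {x y} {us vs : List (List ℕ)} → x > y → Disjoint (map (x ∷_) us) (map (y ∷_) vs)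
  disjoint {x} {y} x>y (i , j) with ∈-map⁻ (x ∷_) i | ∈-map⁻ (y ∷_) j
  ... | _ , _ , refl | _ , _ , e = <⇒≢ x>y (sym (∷-injectiveˡ e))

∣𝒫∣≡length-completions : ∀ n → ∣𝒫∣ n (p12313 ∷ p12323 ∷ []) ≡ length (completions n 0 [])
∣𝒫∣≡length-completions n = ↭-length (∼bag⇒↭ (unique∧set⇒bag
  (𝒫-list-unique n B) (completions-unique n Stack-[])
  (λ {w} → mk⇔ (to w ∘ Equivalence.to (∈-𝒫-list n B w))
               (Equivalence.from (∈-𝒫-list n B w) ∘ from w))))
  where
  B = p12313 ∷ p12323 ∷ []
  to : ∀ w → 𝒫 n B w → w ∈ completions n 0 []
  to w (mk𝒫 refl r (a₁ ∷ a₂ ∷ [])) = ∈-completions⁺ w Stack-[]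
    (mkCompletion g (avoids⇒valleyFree g a₁ a₂) (λ ())
                  (λ 3≤c c≤0 → contradiction (≤-trans 3≤c c≤0) λ ()))
    where g = IsRGS⇒Growth r
  from : ∀ w → w ∈ completions n 0 [] → 𝒫 n B w
  from w w∈ =
    let e , mkCompletion g vf _ _ = ∈-completions⁻ n Stack-[] w∈
    in mk𝒫 e (Growth⇒IsRGS g)
         (valleyFree⇒avoids g vf (s≤s (s≤s z≤n)) ∷ valleyFree⇒avoids g vf ≤-refl ∷ [])

------------------------------------------------------------------------
-- Binomial coefficients

choose-absorb : ∀ n k → suc k * (suc n C suc k) ≡ suc n * (n C k)
choose-absorb zero    zero    = refl
choose-absorb zero    (suc k) = *-zeroʳ (suc (suc k))
choose-absorb (suc n) zero    = begin
  1 * ((2 + n) C 1)         ≡⟨ trans (*-identityˡ _) (nC1≡n (2 + n)) ⟩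
  2 + n                     ≡⟨ *-identityʳ (2 + n) ⟨
  (2 + n) * (suc n C 0)     ∎
  where open ≡-Reasoning
choose-absorb (suc n) (suc k) = begin
  (2 + k) * ((2 + n) C (2 + k))
    ≡⟨ cong ((2 + k) *_) (nCk+nC[k+1]≡[n+1]C[k+1] (suc n) (suc k)) ⟨
  (2 + k) * (c + d)
    ≡⟨ solve 3 (λ k c d → (con 2 :+ k) :* (c :+ d) :=
                          c :+ (con 1 :+ k) :* c :+ (con 2 :+ k) :* d) refl k c d ⟩
  c + suc k * c + (2 + k) * d
    ≡⟨ cong₂ (λ a b → c + a + b) (choose-absorb n k) (choose-absorb n (suc k)) ⟩
  c + suc n * (n C k) + suc n * (n C suc k)
    ≡⟨ solve 4 (λ n a b c → c :+ (con 1 :+ n) :* a :+ (con 1 :+ n) :* b :=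
                            c :+ (con 1 :+ n) :* (a :+ b)) refl n (n C k) (n C suc k) c ⟩
  c + suc n * ((n C k) + (n C suc k))
    ≡⟨ cong (λ a → c + suc n * a) (nCk+nC[k+1]≡[n+1]C[k+1] n k) ⟩
  (2 + n) * c ∎
  where
  open ≡-Reasoning
  open ℕ-Solver
  c = suc n C suc k
  d = suc n C (2 + k)

choose-middle : ∀ n → (suc (n + n) C n) ≡ (suc (n + n) C suc n)
choose-middle n = trans (nCk≡nC[n∸k] (≤-trans (m≤m+n n n) (n≤1+n _)))
  (cong (suc (n + n) C_) (trans (+-∸-assoc 1 (m≤m+n n n)) (cong suc (m+n∸m≡n n n))))

choose-double : ∀ n → ((suc n + suc n) C suc n) ≡ 2 * (suc (n + n) C n)
choose-double n = begin
  ((suc n + suc n) C suc n)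
    ≡⟨ cong (λ k → suc k C suc n) (+-suc n n) ⟩
  ((2 + (n + n)) C suc n)
    ≡⟨ nCk+nC[k+1]≡[n+1]C[k+1] (suc (n + n)) n ⟨
  (suc (n + n) C n) + (suc (n + n) C suc n)
    ≡⟨ cong ((suc (n + n) C n) +_) (trans (sym (choose-middle n)) (sym (+-identityʳ _))) ⟩
  2 * (suc (n + n) C n) ∎
  where open ≡-Reasoning

central-step : ∀ n → suc n * ((suc n + suc n) C suc n) ≡ (2 + 4 * n) * ((n + n) C n)
central-step n = begin
  suc n * ((suc n + suc n) C suc n)
    ≡⟨ cong (suc n *_) (choose-double n) ⟩
  suc n * (2 * (suc (n + n) C n))
    ≡⟨ cong (λ a → suc n * (2 * a)) (choose-middle n) ⟩
  suc n * (2 * (suc (n + n) C suc n))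
    ≡⟨ solve 2 (λ n a → n :* (con 2 :* a) := con 2 :* (n :* a)) refl
               (suc n) (suc (n + n) C suc n) ⟩
  2 * (suc n * (suc (n + n) C suc n))
    ≡⟨ cong (2 *_) (choose-absorb (n + n) n) ⟩
  2 * (suc (n + n) * ((n + n) C n))
    ≡⟨ solve 2 (λ n a → con 2 :* ((con 1 :+ (n :+ n)) :* a) := (con 2 :+ con 4 :* n) :* a) refl
               n ((n + n) C n) ⟩
  (2 + 4 * n) * ((n + n) C n) ∎
  where
  open ≡-Reasoning
  open ℕ-Solver

------------------------------------------------------------------------
-- Counting completions

length-concatMap : ∀ {A B : Set} (f : A → List B) xs →
                   length (concatMap f xs) ≡ sum (map (length ∘ f) xs)
length-concatMap f []       = refl
length-concatMap f (x ∷ xs) =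
  trans (length-++ (f x)) (cong (length (f x) +_) (length-concatMap f xs))

length-completions-suc : ∀ n m s → length (completions (suc n) m s) ≡
                         sum (map (λ (x , t) → length (completions n (m ⊔ x) t)) (moves m s))
length-completions-suc n m s = trans
  (length-concatMap (λ (x , t) → map (x ∷_) (completions n (m ⊔ x) t)) (moves m s))
  (cong sum (map-cong (λ (x , t) → length-map (x ∷_) (completions n (m ⊔ x) t)) (moves m s)))

-- C(2n+k+1, n) + ... + C(2n+2, n) + 2 C(2n+1, n) = C(2n+k+2, n+1), where k is
-- the height of the stack s.
pascal-returns : ∀ n s → sum (map (λ (_ , t) → suc (length t + (n + n)) C n) (returns s))
                         + 2 * (suc (n + n) C n)
                       ≡ (length s + (suc n + suc n)) C suc n
pascal-returns n []      = sym (choose-double n)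
pascal-returns n (c ∷ s) = begin
  b + rest + 2 * (suc (n + n) C n)
    ≡⟨ +-assoc b rest _ ⟩
  b + (rest + 2 * (suc (n + n) C n))
    ≡⟨ cong₂ _+_ (cong (_C n) (shift n (length s))) (pascal-returns n s) ⟩
  (k C n) + (k C suc n)
    ≡⟨ nCk+nC[k+1]≡[n+1]C[k+1] k n ⟩
  suc k C suc n ∎
  where
  open ≡-Reasoning
  b    = suc (suc (length s) + (n + n)) C n
  rest = sum (map (λ (_ , t) → suc (length t + (n + n)) C n) (returns s))
  k    = length s + (suc n + suc n)
  shift : ∀ n l → suc (suc l + (n + n)) ≡ l + (suc n + suc n)
  shift = solve 2 (λ n l → con 2 :+ (l :+ (n :+ n)) := l :+ ((con 1 :+ n) :+ (con 1 :+ n))) refl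
    where open ℕ-Solver

length-completions : ∀ n {m} s → 2 ≤ m →
                     length (completions n m s) ≡ suc (length s + (n + n)) C n
length-completions zero    s 2≤m = refl
length-completions (suc n) {1} s (s≤s ())
length-completions (suc n) {m@(suc (suc _))} s 2≤m = begin
  length (completions (suc n) m s)
    ≡⟨ length-completions-suc n m s ⟩
  sum (map (λ (x , t) → length (completions n (m ⊔ x) t)) (moves m s))
    ≡⟨ cong sum (map-cong (λ (x , t) → length-completions n t (≤-trans 2≤m (m≤m⊔n m x)))
                          (moves m s)) ⟩
  b (suc (length s)) + sum (map f (returns s ++ smalls m))
    ≡⟨ cong (λ xs → b (suc (length s)) + sum xs) (map-++ f (returns s) (smalls m)) ⟩
  b (suc (length s)) + sum (map f (returns s) ++ map f (smalls m))
    ≡⟨ cong (b (suc (length s)) +_) (sum-++ (map f (returns s)) _) ⟩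
  b (suc (length s)) + (sum (map f (returns s)) + 2 * b 0)
    ≡⟨ +-assoc (b (suc (length s))) (sum (map f (returns s))) (2 * b 0) ⟨
  b (suc (length s)) + sum (map f (returns s)) + 2 * b 0
    -- Pushing suc m contributes like one more return, to the top of suc m ∷ s.
    ≡⟨ pascal-returns n (suc m ∷ s) ⟩
  (suc (length s) + (suc n + suc n)) C suc n ∎
  where
  open ≡-Reasoning
  b : ℕ → ℕ
  b l = suc (l + (n + n)) C n
  f : ℕ × List ℕ → ℕ
  f (_ , t) = b (length t)

-- A sequence of length n + 2 starts with 1, and its second letter is 1 or 2.
∣𝒫∣-step : ∀ n → ∣𝒫∣ (2 + n) (p12313 ∷ p12323 ∷ []) ≡
                 ∣𝒫∣ (1 + n) (p12313 ∷ p12323 ∷ []) + (suc (n + n) C n)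
∣𝒫∣-step n = begin
  ∣𝒫∣ (2 + n) (p12313 ∷ p12323 ∷ [])
    ≡⟨ ∣𝒫∣≡length-completions (2 + n) ⟩
  length (completions (2 + n) 0 [])
    ≡⟨ start (suc n) ⟩
  length (completions (suc n) 1 [])
    ≡⟨ length-completions-suc n 1 [] ⟩
  length (completions n 2 []) + (length (completions n 1 []) + 0)
    ≡⟨ cong₂ _+_ (length-completions n [] ≤-refl) (+-identityʳ _) ⟩
  (suc (n + n) C n) + length (completions n 1 [])
    ≡⟨ +-comm (suc (n + n) C n) _ ⟩
  length (completions n 1 []) + (suc (n + n) C n)
    ≡⟨ cong (_+ (suc (n + n) C n)) (trans (∣𝒫∣≡length-completions (1 + n)) (start n)) ⟨
  ∣𝒫∣ (1 + n) (p12313 ∷ p12323 ∷ []) + (suc (n + n) C n) ∎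
  where
  open ≡-Reasoning
  start : ∀ n → length (completions (suc n) 0 []) ≡ length (completions n 1 [])
  start n = trans (length-completions-suc n 0 []) (+-identityʳ _)

------------------------------------------------------------------------
-- The embedding of ℕ into ℚ

ι : ℕ → ℚ
ι n = ℤ.+ n ℚ./ 1

ι-+ : ∀ m n → ι (m + n) ≡ ι m ℚ.+ ι n
ι-+ m n = ℚ.toℚᵘ-injective (begin
  toℚᵘ (ι (m + n))
    ≈⟨ ℚ.toℚᵘ-fromℚᵘ (mkℚᵘ (ℤ.+ (m + n)) 0) ⟩
  mkℚᵘ (ℤ.+ (m + n)) 0
    ≈⟨ *≡* (cong (ℤ._* ℤ.+ 1)
              (sym (cong₂ ℤ._+_ (ℤ.*-identityʳ (ℤ.+ m)) (ℤ.*-identityʳ (ℤ.+ n))))) ⟩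
  mkℚᵘ (ℤ.+ m) 0 ℚᵘ.+ mkℚᵘ (ℤ.+ n) 0
    ≈⟨ ℚᵘ.+-cong (ℚ.toℚᵘ-fromℚᵘ (mkℚᵘ (ℤ.+ m) 0)) (ℚ.toℚᵘ-fromℚᵘ (mkℚᵘ (ℤ.+ n) 0)) ⟨
  toℚᵘ (ι m) ℚᵘ.+ toℚᵘ (ι n)
    ≈⟨ ℚ.toℚᵘ-homo-+ (ι m) (ι n) ⟨
  toℚᵘ (ι m ℚ.+ ι n) ∎)
  where open ℚᵘ.≃-Reasoning

ι-* : ∀ m n → ι (m * n) ≡ ι m ℚ.* ι n
ι-* m n = ℚ.toℚᵘ-injective (begin
  toℚᵘ (ι (m * n))
    ≈⟨ ℚ.toℚᵘ-fromℚᵘ (mkℚᵘ (ℤ.+ (m * n)) 0) ⟩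
  mkℚᵘ (ℤ.+ (m * n)) 0
    ≈⟨ *≡* (cong (ℤ._* ℤ.+ 1) (ℤ.pos-* m n)) ⟩
  mkℚᵘ (ℤ.+ m) 0 ℚᵘ.* mkℚᵘ (ℤ.+ n) 0
    ≈⟨ ℚᵘ.*-cong (ℚ.toℚᵘ-fromℚᵘ (mkℚᵘ (ℤ.+ m) 0)) (ℚ.toℚᵘ-fromℚᵘ (mkℚᵘ (ℤ.+ n) 0)) ⟨
  toℚᵘ (ι m) ℚᵘ.* toℚᵘ (ι n)
    ≈⟨ ℚ.toℚᵘ-homo-* (ι m) (ι n) ⟨
  toℚᵘ (ι m ℚ.* ι n) ∎)
  where open ℚᵘ.≃-Reasoning

ι-suc-nonZero : ∀ n → NonZero (ι (suc n))
ι-suc-nonZero n = ℚ.pos⇒nonZero (ι (suc n)) {{ℚ.normalize-pos (suc n) 1}}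

x*y≡0⇒y≡0 : ∀ x {y} .{{_ : NonZero x}} → x ℚ.* y ≡ 0ℚ → y ≡ 0ℚ
x*y≡0⇒y≡0 x {y} p = begin
  y                    ≡⟨ ℚ.*-identityˡ y ⟨
  1ℚ ℚ.* y             ≡⟨ cong (ℚ._* y) (ℚ.*-inverseˡ x) ⟨
  1/ x ℚ.* x ℚ.* y     ≡⟨ ℚ.*-assoc (1/ x) x y ⟩
  1/ x ℚ.* (x ℚ.* y)   ≡⟨ cong (1/ x ℚ.*_) p ⟩
  1/ x ℚ.* 0ℚ          ≡⟨ ℚ.*-zeroʳ (1/ x) ⟩
  0ℚ                   ∎
  where open ≡-Reasoning

------------------------------------------------------------------------
-- The ring of power series

module ℚ-Sum = Algebra.Properties.Semiring.Sum (CommutativeRing.semiring ℚ.+-*-commutativeRing)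

-- The series (f - f₀) / X.  By definition of the product,
-- (f g)ₙ₊₁ = f₀ gₙ₊₁ + (tail f · g)ₙ, which is what the inductions below use.
tail : Series → Series
tail f n = f (suc n)

*ₛ-cong : ∀ {f f′ g g′} → f ≗ f′ → g ≗ g′ → f *ₛ g ≗ f′ *ₛ g′
*ₛ-cong p q n = ℚ-Sum.sum-cong-≗ {suc n} λ i → cong₂ ℚ._*_ (p (toℕ i)) (q (n ∸ toℕ i))

*ₛ-suc′ : ∀ f g n → (f *ₛ g) (suc n) ≡ f (suc n) ℚ.* g 0 ℚ.+ (f *ₛ tail g) n
*ₛ-suc′ f g zero    =
  solve 4 (λ a b c d → a :* d :+ (b :* c :+ con 0ℚ) := b :* c :+ (a :* d :+ con 0ℚ)) refl
          (f 0) (f 1) (g 0) (g 1)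
  where open ℚ-Solver
*ₛ-suc′ f g (suc n) = trans
  (cong (f 0 ℚ.* g (2 + n) ℚ.+_) (*ₛ-suc′ (tail f) g n))
  (solve 3 (λ a b c → a :+ (b :+ c) := b :+ (a :+ c)) refl
           (f 0 ℚ.* g (2 + n)) (f (2 + n) ℚ.* g 0) ((tail f *ₛ tail g) n))
  where open ℚ-Solver

*ₛ-comm : ∀ f g → f *ₛ g ≗ g *ₛ f
*ₛ-comm f g zero    = cong (ℚ._+ 0ℚ) (ℚ.*-comm (f 0) (g 0))
*ₛ-comm f g (suc n) = trans
  (cong₂ ℚ._+_ (ℚ.*-comm (f 0) (g (suc n))) (*ₛ-comm (tail f) g n))
  (sym (*ₛ-suc′ g f n))

*ₛ-distribʳ : ∀ h f g → (f +ₛ g) *ₛ h ≗ f *ₛ h +ₛ g *ₛ h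
*ₛ-distribʳ h f g n = trans
  (ℚ-Sum.sum-cong-≗ {suc n} λ i → ℚ.*-distribʳ-+ (h (n ∸ toℕ i)) (f (toℕ i)) (g (toℕ i)))
  (ℚ-Sum.∑-distrib-+ {suc n} (λ i → f (toℕ i) ℚ.* h (n ∸ toℕ i))
                             (λ i → g (toℕ i) ℚ.* h (n ∸ toℕ i)))

scale-*ₛ : ∀ c f g n → ((λ k → c ℚ.* f k) *ₛ g) n ≡ c ℚ.* (f *ₛ g) n
scale-*ₛ c f g n = trans
  (ℚ-Sum.sum-cong-≗ {suc n} λ i → ℚ.*-assoc c (f (toℕ i)) (g (n ∸ toℕ i)))
  (sym (ℚ-Sum.*-distribˡ-sum {suc n} c (λ i → f (toℕ i) ℚ.* g (n ∸ toℕ i))))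

*ₛ-assoc : ∀ f g h → (f *ₛ g) *ₛ h ≗ f *ₛ (g *ₛ h)
*ₛ-assoc f g h zero    =
  solve 3 (λ a b c → (a :* b :+ con 0ℚ) :* c :+ con 0ℚ :=
                     a :* (b :* c :+ con 0ℚ) :+ con 0ℚ) refl (f 0) (g 0) (h 0)
  where open ℚ-Solver
*ₛ-assoc f g h (suc n) = begin
  (f 0 ℚ.* g 0 ℚ.+ 0ℚ) ℚ.* h (suc n) ℚ.+ (tail (f *ₛ g) *ₛ h) n
    ≡⟨ cong₂ ℚ._+_ (cong (ℚ._* h (suc n)) (ℚ.+-identityʳ (f 0 ℚ.* g 0)))
                   (*ₛ-distribʳ h (λ k → f 0 ℚ.* tail g k) (tail f *ₛ g) n) ⟩
  f 0 ℚ.* g 0 ℚ.* h (suc n) ℚ.+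
    (((λ k → f 0 ℚ.* tail g k) *ₛ h) n ℚ.+ ((tail f *ₛ g) *ₛ h) n)
    ≡⟨ cong₂ (λ a b → f 0 ℚ.* g 0 ℚ.* h (suc n) ℚ.+ (a ℚ.+ b))
             (scale-*ₛ (f 0) (tail g) h n) (*ₛ-assoc (tail f) g h n) ⟩
  f 0 ℚ.* g 0 ℚ.* h (suc n) ℚ.+ (f 0 ℚ.* (tail g *ₛ h) n ℚ.+ (tail f *ₛ (g *ₛ h)) n)
    ≡⟨ solve 5 (λ a b c d e → a :* b :* c :+ (a :* d :+ e) := a :* (b :* c :+ d) :+ e) refl
               (f 0) (g 0) (h (suc n)) ((tail g *ₛ h) n) ((tail f *ₛ (g *ₛ h)) n) ⟩
  f 0 ℚ.* (g 0 ℚ.* h (suc n) ℚ.+ (tail g *ₛ h) n) ℚ.+ (tail f *ₛ (g *ₛ h)) n ∎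
  where
  open ≡-Reasoning
  open ℚ-Solver

fromℕₛ-*ₛ : ∀ c f n → (fromℕₛ c *ₛ f) n ≡ ι c ℚ.* f n
fromℕₛ-*ₛ c f zero    = ℚ.+-identityʳ (ι c ℚ.* f 0)
fromℕₛ-*ₛ c f (suc n) = trans (cong (ι c ℚ.* f (suc n) ℚ.+_) zero-sum) (ℚ.+-identityʳ _)
  where
  zero-sum : (tail (fromℕₛ c) *ₛ f) n ≡ 0ℚ
  zero-sum = trans (ℚ-Sum.sum-cong-≗ {suc n} λ i → ℚ.*-zeroˡ (f (n ∸ toℕ i)))
                   (ℚ-Sum.sum-replicate-zero (suc n))

*ₛ-identityˡ : ∀ f → fromℕₛ 1 *ₛ f ≗ f
*ₛ-identityˡ f n = trans (fromℕₛ-*ₛ 1 f n) (ℚ.*-identityˡ (f n))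

X-*ₛ-suc : ∀ f n → (X *ₛ f) (suc n) ≡ f n
X-*ₛ-suc f n = trans
  (cong₂ ℚ._+_ (ℚ.*-zeroˡ (f (suc n)))
               (trans (*ₛ-cong {g = f} tail-X (λ _ → refl) n) (*ₛ-identityˡ f n)))
  (ℚ.+-identityˡ (f n))
  where
  tail-X : tail X ≗ fromℕₛ 1
  tail-X zero    = refl
  tail-X (suc _) = refl

seriesRing : CommutativeRing 0ℓ 0ℓ
seriesRing = record
  { Carrier = Series
  ; _≈_     = _≗_
  ; _+_     = _+ₛ_
  ; _*_     = _*ₛ_
  ; -_      = λ f n → ℚ.- f n
  ; 0#      = λ _ → 0ℚ
  ; 1#      = fromℕₛ 1
  ; isCommutativeRing = record
    { isRing = record
      { +-isAbelianGroup = record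
        { isGroup = record
          { isMonoid = record
            { isSemigroup = record
              { isMagma = record
                { isEquivalence = record
                  { refl  = λ _ → refl
                  ; sym   = λ p n → sym (p n)
                  ; trans = λ p q n → trans (p n) (q n) }
                ; ∙-cong = λ p q n → cong₂ ℚ._+_ (p n) (q n) }
              ; assoc = λ f g h n → ℚ.+-assoc (f n) (g n) (h n) }
            ; identity = (λ f n → ℚ.+-identityˡ (f n)) , (λ f n → ℚ.+-identityʳ (f n)) }
          ; inverse = (λ f n → ℚ.+-inverseˡ (f n)) , (λ f n → ℚ.+-inverseʳ (f n))
          ; ⁻¹-cong = λ p n → cong (λ a → ℚ.- a) (p n) }
        ; comm = λ f g n → ℚ.+-comm (f n) (g n) }
      ; *-cong     = *ₛ-cong
      ; *-assoc    = *ₛ-assoc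
      ; *-identity =
          *ₛ-identityˡ ,
          (λ f n → trans (*ₛ-comm f (fromℕₛ 1) n) (*ₛ-identityˡ f n))
      ; distrib    =
          (λ h f g n → trans (*ₛ-comm h (f +ₛ g) n)
             (trans (*ₛ-distribʳ h f g n) (cong₂ ℚ._+_ (*ₛ-comm f h n) (*ₛ-comm g h n)))) ,
          *ₛ-distribʳ }
    ; *-comm = *ₛ-comm } }

module R = CommutativeRing seriesRing

module ≗-Reasoning = Relation.Binary.Reasoning.Setoid R.setoid

module SeriesSolver = Algebra.Solver.Ring.NaturalCoefficients.Default R.commutativeSemiring

-ₛ-*ₛ : ∀ f g h → (f -ₛ g) *ₛ h ≗ f *ₛ h -ₛ g *ₛ h
-ₛ-*ₛ f g h = Algebra.Properties.Ring.[y-z]x≈yx-zx R.ring h f g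

-- A series with nonzero constant term is invertible.
*ₛ-cancelˡ : ∀ f {g h} .{{_ : NonZero (f 0)}} → f *ₛ g ≗ f *ₛ h → g ≗ h
*ₛ-cancelˡ f {g} {h} p = begin
  g                   ≈⟨ R.*-identityˡ g ⟨
  fromℕₛ 1 *ₛ g       ≈⟨ R.*-congʳ {x = g} (/ₛ-*ₛ (fromℕₛ 1) f) ⟨
  (f⁻¹ *ₛ f) *ₛ g     ≈⟨ *ₛ-assoc f⁻¹ f g ⟩
  f⁻¹ *ₛ (f *ₛ g)     ≈⟨ R.*-congˡ {x = f⁻¹} p ⟩
  f⁻¹ *ₛ (f *ₛ h)     ≈⟨ *ₛ-assoc f⁻¹ f h ⟨
  (f⁻¹ *ₛ f) *ₛ h     ≈⟨ R.*-congʳ {x = h} (/ₛ-*ₛ (fromℕₛ 1) f) ⟩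
  fromℕₛ 1 *ₛ h       ≈⟨ R.*-identityˡ h ⟩
  h                   ∎
  where
  open ≗-Reasoning
  f⁻¹ = fromℕₛ 1 /ₛ f

-- The derivation X d/dX.
θ : Series → Series
θ f n = ι n ℚ.* f n

θ-leibniz : ∀ f g → θ (f *ₛ g) ≗ θ f *ₛ g +ₛ f *ₛ θ g
θ-leibniz f g n = trans
  (ℚ-Sum.*-distribˡ-sum {suc n} (ι n) (λ i → f (toℕ i) ℚ.* g (n ∸ toℕ i)))
  (trans (ℚ-Sum.sum-cong-≗ {suc n} term)
         (ℚ-Sum.∑-distrib-+ {suc n} (λ i → θ f (toℕ i) ℚ.* g (n ∸ toℕ i))
                                    (λ i → f (toℕ i) ℚ.* θ g (n ∸ toℕ i))))
  where
  open ℚ-Solver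
  term : ∀ i → ι n ℚ.* (f (toℕ i) ℚ.* g (n ∸ toℕ i)) ≡
               θ f (toℕ i) ℚ.* g (n ∸ toℕ i) ℚ.+ f (toℕ i) ℚ.* θ g (n ∸ toℕ i)
  term i = trans
    (cong (ℚ._* (f (toℕ i) ℚ.* g (n ∸ toℕ i)))
      (trans (cong ι (sym (m+[n∸m]≡n (toℕ≤pred[n] i)))) (ι-+ (toℕ i) (n ∸ toℕ i))))
    (solve 4 (λ a b c d → (a :+ b) :* (c :* d) := a :* c :* d :+ c :* (b :* d)) refl
             (ι (toℕ i)) (ι (n ∸ toℕ i)) (f (toℕ i)) (g (n ∸ toℕ i)))

------------------------------------------------------------------------
-- The reciprocal of the square root of 1 - 4X

1-4X : Series
1-4X = fromℕₛ 1 -ₛ fromℕₛ 4 *ₛ X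

√1-4X : Series
√1-4X = sqrt 1-4X refl

-- The generating function of the central binomial coefficients.
central : Series
central = genFun (λ n → (n + n) C n)

θ-central : ∀ n → θ central n ≡ ι 4 ℚ.* (X *ₛ θ central) n ℚ.+ ι 2 ℚ.* (X *ₛ central) n
θ-central zero    = refl
θ-central (suc n) = begin
  ι (suc n) ℚ.* central (suc n)
    ≡⟨ ι-* (suc n) ((suc n + suc n) C suc n) ⟨
  ι (suc n * ((suc n + suc n) C suc n))
    ≡⟨ cong ι (central-step n) ⟩
  ι ((2 + 4 * n) * ((n + n) C n))
    ≡⟨ ι-* (2 + 4 * n) ((n + n) C n) ⟩
  ι (2 + 4 * n) ℚ.* central n
    ≡⟨ cong (ℚ._* central n) (trans (ι-+ 2 (4 * n)) (cong (ι 2 ℚ.+_) (ι-* 4 n))) ⟩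
  (ι 2 ℚ.+ ι 4 ℚ.* ι n) ℚ.* central n
    ≡⟨ solve 4 (λ a b c d → (a :+ b :* c) :* d := b :* (c :* d) :+ a :* d) refl
               (ι 2) (ι 4) (ι n) (central n) ⟩
  ι 4 ℚ.* θ central n ℚ.+ ι 2 ℚ.* central n
    ≡⟨ cong₂ (λ a b → ι 4 ℚ.* a ℚ.+ ι 2 ℚ.* b)
             (X-*ₛ-suc (θ central) n) (X-*ₛ-suc central n) ⟨
  ι 4 ℚ.* (X *ₛ θ central) (suc n) ℚ.+ ι 2 ℚ.* (X *ₛ central) (suc n) ∎
  where
  open ≡-Reasoning
  open ℚ-Solver

1-4X-θ-central : 1-4X *ₛ θ central ≗ X *ₛ central +ₛ X *ₛ central
1-4X-θ-central n = begin
  (1-4X *ₛ θ central) n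
    ≡⟨ -ₛ-*ₛ (fromℕₛ 1) (fromℕₛ 4 *ₛ X) (θ central) n ⟩
  (fromℕₛ 1 *ₛ θ central) n ℚ.- (fromℕₛ 4 *ₛ X *ₛ θ central) n
    ≡⟨ cong₂ ℚ._-_
         (trans (*ₛ-identityˡ (θ central) n) (θ-central n))
         (trans (*ₛ-assoc (fromℕₛ 4) X (θ central) n) (fromℕₛ-*ₛ 4 (X *ₛ θ central) n)) ⟩
  ι 4 ℚ.* (X *ₛ θ central) n ℚ.+ ι 2 ℚ.* (X *ₛ central) n ℚ.- ι 4 ℚ.* (X *ₛ θ central) n
    ≡⟨ solve 2 (λ a b → con (ι 4) :* a :+ con (ι 2) :* b :- con (ι 4) :* a := b :+ b) refl
               ((X *ₛ θ central) n) ((X *ₛ central) n) ⟩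
  (X *ₛ central) n ℚ.+ (X *ₛ central) n ∎
  where
  open ≡-Reasoning
  open ℚ-Solver

θ-1-4X : θ 1-4X +ₛ (X +ₛ X +ₛ X +ₛ X) ≗ R.0#
θ-1-4X 0             = refl
θ-1-4X 1             = refl
θ-1-4X (suc (suc n)) = trans
  (cong (λ a → ι (2 + n) ℚ.* (0ℚ ℚ.- a) ℚ.+ 0ℚ) (fromℕₛ-*ₛ 4 X (2 + n)))
  (trans (ℚ.+-identityʳ _) (ℚ.*-zeroʳ (ι (2 + n))))

-- Doubled, so that the relation for θ S enters in the symmetric form
-- θ(S S) = θ S · S + S · θ S.
θ-central-√ : θ (central *ₛ √1-4X) +ₛ θ (central *ₛ √1-4X) ≗ R.0#
θ-central-√ = *ₛ-cancelˡ 1-4X (begin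
  u *ₛ (θ (B *ₛ S) +ₛ θ (B *ₛ S))
    ≈⟨ R.*-congˡ {x = u} (R.+-cong (θ-leibniz B S) (θ-leibniz B S)) ⟩
  u *ₛ ((θ B *ₛ S +ₛ B *ₛ θ S) +ₛ (θ B *ₛ S +ₛ B *ₛ θ S))
    ≈⟨ solve 5 (λ u b b′ s s′ →
                  u :* ((b′ :* s :+ b :* s′) :+ (b′ :* s :+ b :* s′)) :=
                  ((u :* b′) :* s :+ (u :* b′) :* s) :+ u :* (b :* s′ :+ b :* s′))
               R.refl u B (θ B) S (θ S) ⟩
  ((u *ₛ θ B) *ₛ S +ₛ (u *ₛ θ B) *ₛ S) +ₛ u *ₛ (B *ₛ θ S +ₛ B *ₛ θ S)
    ≈⟨ R.+-cong (R.+-cong (R.*-congʳ {x = S} 1-4X-θ-central) (R.*-congʳ {x = S} 1-4X-θ-central))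
                (R.*-congʳ {x = B *ₛ θ S +ₛ B *ₛ θ S} (R.sym SS)) ⟩
  ((X *ₛ B +ₛ X *ₛ B) *ₛ S +ₛ (X *ₛ B +ₛ X *ₛ B) *ₛ S) +ₛ (S *ₛ S) *ₛ (B *ₛ θ S +ₛ B *ₛ θ S)
    ≈⟨ solve 4 (λ x b s s′ →
                  ((x :* b :+ x :* b) :* s :+ (x :* b :+ x :* b) :* s)
                    :+ (s :* s) :* (b :* s′ :+ b :* s′) :=
                  (b :* s) :* ((s′ :* s :+ s :* s′) :+ (x :+ x :+ x :+ x)))
               R.refl X B S (θ S) ⟩
  (B *ₛ S) *ₛ ((θ S *ₛ S +ₛ S *ₛ θ S) +ₛ 4X)
    ≈⟨ R.*-congˡ {x = B *ₛ S} (R.+-congʳ {x = 4X} (R.sym (θ-leibniz S S))) ⟩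
  (B *ₛ S) *ₛ (θ (S *ₛ S) +ₛ 4X)
    ≈⟨ R.*-congˡ {x = B *ₛ S} (R.+-congʳ {x = 4X} (λ n → cong (ι n ℚ.*_) (SS n))) ⟩
  (B *ₛ S) *ₛ (θ u +ₛ 4X)
    ≈⟨ R.*-congˡ {x = B *ₛ S} θ-1-4X ⟩
  (B *ₛ S) *ₛ R.0#
    ≈⟨ R.trans (R.zeroʳ (B *ₛ S)) (R.sym (R.zeroʳ u)) ⟩
  u *ₛ R.0# ∎)
  where
  open ≗-Reasoning
  open SeriesSolver using (solve; _:*_; _:+_; _:=_)
  u  = 1-4X
  B  = central
  S  = √1-4X
  4X = X +ₛ X +ₛ X +ₛ X
  SS : S *ₛ S ≗ u
  SS = sqrt-*ₛ u refl

central-√ : central *ₛ √1-4X ≗ fromℕₛ 1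
central-√ zero    = refl
central-√ (suc n) = x*y≡0⇒y≡0 (ι (suc n)) {{ι-suc-nonZero n}} (x*y≡0⇒y≡0 (ι 2)
  (trans (solve 1 (λ a → con (ι 2) :* a := a :+ a) refl (θ (central *ₛ √1-4X) (suc n)))
         (θ-central-√ (suc n))))
  where open ℚ-Solver

1/√1-4X : fromℕₛ 1 /ₛ √1-4X ≗ central
1/√1-4X = *ₛ-cancelˡ √1-4X (begin
  √1-4X *ₛ (fromℕₛ 1 /ₛ √1-4X)   ≈⟨ *ₛ-comm √1-4X (fromℕₛ 1 /ₛ √1-4X) ⟩
  (fromℕₛ 1 /ₛ √1-4X) *ₛ √1-4X   ≈⟨ /ₛ-*ₛ (fromℕₛ 1) √1-4X ⟩
  fromℕₛ 1                       ≈⟨ central-√ ⟨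
  central *ₛ √1-4X               ≈⟨ *ₛ-comm central √1-4X ⟩
  √1-4X *ₛ central               ∎)
  where open ≗-Reasoning

------------------------------------------------------------------------
-- The generating function

-- The recurrence ∣𝒫∣-step in terms of series.
2[1-X]-genFun : fromℕₛ 2 *ₛ (fromℕₛ 1 -ₛ X) *ₛ genFun (λ n → ∣𝒫∣ n (p12313 ∷ p12323 ∷ [])) ≗
                fromℕₛ 2 +ₛ X *ₛ (central -ₛ fromℕₛ 1)
2[1-X]-genFun 0             = refl
2[1-X]-genFun 1             = refl
2[1-X]-genFun (suc (suc n)) = begin
  (fromℕₛ 2 *ₛ (fromℕₛ 1 -ₛ X) *ₛ A) (2 + n)
    ≡⟨ *ₛ-assoc (fromℕₛ 2) (fromℕₛ 1 -ₛ X) A (2 + n) ⟩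
  (fromℕₛ 2 *ₛ ((fromℕₛ 1 -ₛ X) *ₛ A)) (2 + n)
    ≡⟨ fromℕₛ-*ₛ 2 ((fromℕₛ 1 -ₛ X) *ₛ A) (2 + n) ⟩
  ι 2 ℚ.* ((fromℕₛ 1 -ₛ X) *ₛ A) (2 + n)
    ≡⟨ cong (ι 2 ℚ.*_) (trans (-ₛ-*ₛ (fromℕₛ 1) X A (2 + n))
         (cong₂ ℚ._-_ (*ₛ-identityˡ A (2 + n)) (X-*ₛ-suc A (suc n)))) ⟩
  ι 2 ℚ.* (A (2 + n) ℚ.- A (suc n))
    ≡⟨ cong (λ a → ι 2 ℚ.* (a ℚ.- A (suc n)))
         (trans (cong ι (∣𝒫∣-step n)) (ι-+ (∣𝒫∣ (suc n) (p12313 ∷ p12323 ∷ [])) b)) ⟩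
  ι 2 ℚ.* (A (suc n) ℚ.+ ι b ℚ.- A (suc n))
    ≡⟨ solve 2 (λ a b → con (ι 2) :* (a :+ b :- a) :=
                        con 0ℚ :+ (con (ι 2) :* b :- con 0ℚ)) refl (A (suc n)) (ι b) ⟩
  0ℚ ℚ.+ (ι 2 ℚ.* ι b ℚ.- 0ℚ)
    ≡⟨ cong (λ a → 0ℚ ℚ.+ (a ℚ.- 0ℚ)) (trans (sym (ι-* 2 b)) (cong ι (sym (choose-double n)))) ⟩
  0ℚ ℚ.+ (central (suc n) ℚ.- 0ℚ)
    ≡⟨ cong (0ℚ ℚ.+_) (X-*ₛ-suc (central -ₛ fromℕₛ 1) (suc n)) ⟨
  0ℚ ℚ.+ (X *ₛ (central -ₛ fromℕₛ 1)) (2 + n) ∎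
  where
  open ≡-Reasoning
  open ℚ-Solver
  A = genFun (λ n → ∣𝒫∣ n (p12313 ∷ p12323 ∷ []))
  b = suc (n + n) C n

mainTheorem7 : genFun (λ (n : ℕ) → ∣𝒫∣ n ((1 ∷ 2 ∷ 3 ∷ 1 ∷ 3 ∷ []) ∷ (1 ∷ 2 ∷ 3 ∷ 2 ∷ 3 ∷ []) ∷ []))
    ≗
    fromℕₛ 1 /ₛ (fromℕₛ 1 -ₛ X)
    +ₛ X /ₛ (fromℕₛ 2 *ₛ (fromℕₛ 1 -ₛ X))
    *ₛ (fromℕₛ 1 /ₛ sqrt (fromℕₛ 1 -ₛ fromℕₛ 4 *ₛ X) refl -ₛ fromℕₛ 1)
mainTheorem7 = *ₛ-cancelˡ c (begin
  c *ₛ genFun (λ n → ∣𝒫∣ n (p12313 ∷ p12323 ∷ []))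
    ≈⟨ 2[1-X]-genFun ⟩
  fromℕₛ 2 +ₛ X *ₛ (central -ₛ fromℕₛ 1)
    ≈⟨ R.+-cong cE (R.*-cong (/ₛ-*ₛ X c) (λ n → cong (ℚ._- fromℕₛ 1 n) (1/√1-4X n))) ⟨
  c *ₛ E +ₛ (Q *ₛ c) *ₛ D
    ≈⟨ solve 4 (λ c e q d → c :* e :+ (q :* c) :* d := c :* (e :+ q :* d)) R.refl c E Q D ⟩
  c *ₛ (E +ₛ Q *ₛ D) ∎)
  where
  open ≗-Reasoning
  open SeriesSolver using (solve; _:*_; _:+_; _:=_)
  c = fromℕₛ 2 *ₛ (fromℕₛ 1 -ₛ X)
  E = fromℕₛ 1 /ₛ (fromℕₛ 1 -ₛ X)
  Q = X /ₛ c
  D = fromℕₛ 1 /ₛ √1-4X -ₛ fromℕₛ 1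
  cE : c *ₛ E ≗ fromℕₛ 2
  cE = begin
    (fromℕₛ 2 *ₛ (fromℕₛ 1 -ₛ X)) *ₛ E
      ≈⟨ *ₛ-assoc (fromℕₛ 2) (fromℕₛ 1 -ₛ X) E ⟩
    fromℕₛ 2 *ₛ ((fromℕₛ 1 -ₛ X) *ₛ E)
      ≈⟨ R.*-congˡ {x = fromℕₛ 2} (R.trans (*ₛ-comm (fromℕₛ 1 -ₛ X) E)
                                           (/ₛ-*ₛ (fromℕₛ 1) (fromℕₛ 1 -ₛ X))) ⟩
    fromℕₛ 2 *ₛ fromℕₛ 1
      ≈⟨ R.*-identityʳ (fromℕₛ 2) ⟩
    fromℕₛ 2 ∎
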